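{- For every odd partition $\lambda$ with $|\lambda|>1$, there exists a unique odd partition $\mu\in\lambda^-$. In other words, the subgraph induced in Young's graph by the set $\Lambda^{\mathrm{odd}}$ of odd partitions is a rooted tree (rooted at $\emptyset$).
   Context: For a partition $\lambda$, $f_\lambda$ is the number of standard Young tableaux of shape $\lambda$ (equivalently the number of saturated chains from $\emptyset$ to $\lambda$ in Young's lattice); $\lambda$ is odd if $f_\lambda$ is odd, and $\Lambda^{\mathrm{odd}}$ is the set of odd partitions. Young's lattice is the set of partitions ordered by containment of Young diagrams, Young's graph its Hasse diagram. $\lambda^-$ denotes the set of partitions covered by $\lambda$ in Young's lattice (obtained by removing one cell). -}

module Defs where

open import Data.Nat using (ℕ; zero; suc; _+_; _≤_; _<_; _≥_; _%_; pred)
open import Data.Nat.Properties using (_≤?_; _≟_)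
open import Data.List using (List; []; _∷_; map; filter; length)
open import Data.Nat.ListAction using (sum)
open import Data.List.Relation.Unary.All using (All)
open import Data.List.Relation.Unary.Linked using (Linked)
open import Data.List.Relation.Binary.Pointwise using (Pointwise)
open import Data.Product using (_×_)
open import Relation.Binary.PropositionalEquality using (_≡_)
open import Relation.Nullary using (Dec; yes; no)
open import Relation.Nullary.Decidable using (⌊_⌋)
open import Data.Bool using (Bool; true; false; if_then_else_)

IsPartition : List ℕ → Set
IsPartition xs = All (λ x → 1 ≤ x) xs × Linked _≥_ xs

size : List ℕ → ℕ
size = sum

data _⊆Y_ : List ℕ → List ℕ → Set where
  []⊆ : ∀ {ys} → [] ⊆Y ys
  ∷⊆  : ∀ {x y xs ys} → x ≤ y → xs ⊆Y ys → (x ∷ xs) ⊆Y (y ∷ ys)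

_⋖_ : List ℕ → List ℕ → Set
μ ⋖ λ′ = IsPartition μ × IsPartition λ′ × μ ⊆Y λ′ × size λ′ ≡ suc (size μ)

-- Computational enumeration of candidate lists obtained by removing one
-- cell from a row (decrement one part).  Candidates that are not weakly
-- decreasing are discarded; then a resulting trailing zero part is dropped.
dropZero : List ℕ → List ℕ
dropZero [] = []
dropZero (zero ∷ xs) = dropZero xs
dropZero (suc x ∷ xs) = suc x ∷ dropZero xs

decAt : List ℕ → List (List ℕ)
decAt [] = []
decAt (x ∷ xs) = (pred x ∷ xs) ∷ map (x ∷_) (decAt xs)

isDecreasing : List ℕ → Bool
isDecreasing [] = true
isDecreasing (x ∷ []) = true
isDecreasing (x ∷ y ∷ xs) = if ⌊ y ≤? x ⌋ then isDecreasing (y ∷ xs) else false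

-- λ⁻ : the partitions covered by λ (each obtained by removing one corner cell)
lower : List ℕ → List (List ℕ)
lower xs = map dropZero (filter (λ ys → isDecreasing ys Data.Bool.≟ true) (decAt xs))

-- number of saturated chains from ∅ to λ (fuel = |λ| suffices)
chains : ℕ → List ℕ → ℕ
chains zero xs = 1
chains (suc n) [] = 1
chains (suc n) (x ∷ xs) = sum (map (chains n) (lower (x ∷ xs)))

-- f_λ = number of standard Young tableaux of shape λ
f : List ℕ → ℕ
f λ′ = chains (size λ′) λ′

Odd : List ℕ → Set
Odd λ′ = f λ′ % 2 ≡ 1

{-# OPTIONS --safe #-}
module Submission where

-- Encode a partition with r parts by its beta-set x, a vector of r distinct positive numbers; removing a cell lowers one
-- entry of x by 1. Modulo 2, the number of tableaux extends to a symmetric function of all vectors which vanishes on vectors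
-- with a repeated or a zero entry and satisfies f(x) = Σᵢ f(x − eᵢ). The shift operators commute, so by Frobenius
-- f(x) = Σᵢ f(x − t eᵢ) for t = 2ᵏ. Let t ≤ |x| < 2t, and let y = x − t eᵢ be odd. For |x| = t, x is a hook with at most two
-- removable cells, and f(x) is the sum of the two values of f, so exactly one is odd. For |x| > t, the odd x − eₐ map
-- injectively to odd vectors y − e_c, and induction applies to y: two entries of x cannot both be lowered by t,
-- so x − eₐ is nearly always reduced at the same entry i as x.

open import Defs
open import Algebra.Bundles using (CommutativeRing)
open import Data.Bool using (Bool; true; false; not; _xor_; if_then_else_)
open import Data.Bool.Properties using (xor-∧-commutativeRing; xor-identityʳ; xor-same; xor-assoc; not-involutive; not-distribˡ-xor) renaming (_≟_ to _≟ᵇ_)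
open import Data.Fin using (Fin; zero; suc; punchIn)
open import Data.Fin.Permutation using (Permutation′; _⟨$⟩ʳ_; _⟨$⟩ˡ_; inverseˡ; inverseʳ; flip; transpose)
open import Data.Fin.Properties using (any?; punchIn-injective; punchInᵢ≢i) renaming (_≟_ to _≟ᶠ_; suc-injective to sucᶠ-injective)
open import Data.List using (List; []; _∷_; map; filter; tabulate)
open import Data.List.Properties using (map-tabulate; ∷-injective)
open import Data.List.Relation.Unary.All using (All; []; _∷_)
open import Data.List.Relation.Unary.Linked as Linked using (Linked; []; [-]; _∷_)
open import Data.Nat using (ℕ; zero; suc; _+_; _∸_; _^_; _≤_; _<_; _≥_; _<?_; z≤n; s≤s; pred; _≟_; _%_; >-nonZero)
open import Data.Nat.ListAction using (sum)
open import Data.Nat.Properties hiding (_≟_; _<?_)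
open import Data.Product using (Σ; _×_; _,_; proj₁; ∃)
open import Data.Sum using (_⊎_; inj₁; inj₂)
open import Data.Vec using (Vec; []; _∷_; lookup; _[_]%=_; _[_]≔_; toList; fromList)
open import Data.Vec.Properties using (lookup∘updateAt; lookup∘updateAt′; updateAt-commutes; updateAt-updateAt; updateAt-updateAt-local; toList∘fromList)
open import Function using (_∘_)
open import Relation.Binary.PropositionalEquality using (_≡_; _≢_; refl; sym; trans; cong; cong₂; subst; subst₂; module ≡-Reasoning)
open import Relation.Nullary using (¬_; Dec; yes; no; does; contradiction)
open import Relation.Nullary.Decidable using (dec-true; dec-false; ¬?; _×-dec_)

open import Algebra.Properties.CommutativeMonoid.Sum (CommutativeRing.+-commutativeMonoid xor-∧-commutativeRing) using (sum-cong-≗; sum-permute; ∑-distrib-+) renaming (sum to ⨁)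
open import Algebra.Properties.CommutativeMonoid.Sum +-0-commutativeMonoid using () renaming (sum to ∑; sum-remove to ∑-remove)

-- Sums modulo 2

true≢false : ∀ {b} → b ≡ true → b ≢ false
true≢false refl ()

⨁-zero : ∀ {n} (h : Fin n → Bool) → (∀ c → h c ≡ false) → ⨁ h ≡ false
⨁-zero {zero}  h z = refl
⨁-zero {suc n} h z rewrite z zero = ⨁-zero (h ∘ suc) (z ∘ suc)

⨁-true : ∀ {n} (h : Fin n → Bool) → ⨁ h ≡ true → ∃ λ i → h i ≡ true
⨁-true {suc n} h e with h zero in h₀
... | true  = zero , h₀
... | false with ⨁-true (h ∘ suc) e
...   | i , hᵢ = suc i , hᵢ

⨁-single : ∀ {n} (h : Fin n → Bool) a → (∀ c → c ≢ a → h c ≡ false) → ⨁ h ≡ h a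
⨁-single h zero    z = trans (cong (h zero xor_) (⨁-zero (h ∘ suc) λ c → z (suc c) λ ())) (xor-identityʳ _)
⨁-single h (suc a) z rewrite z zero (λ ()) = ⨁-single (h ∘ suc) a λ c c≢a → z (suc c) λ { refl → c≢a refl }

⨁-pair : ∀ {n} (h : Fin n → Bool) a b → a ≢ b → h a ≡ h b →
         (∀ c → c ≢ a → c ≢ b → h c ≡ false) → ⨁ h ≡ false
⨁-pair h zero zero a≢b _ _ = contradiction refl a≢b
⨁-pair h zero (suc b) _ e z =
  trans (cong₂ _xor_ e (⨁-single (h ∘ suc) b λ c c≢b → z (suc c) (λ ()) λ { refl → c≢b refl })) (xor-same (h (suc b)))
⨁-pair h (suc a) zero _ e z =
  trans (cong₂ _xor_ (sym e) (⨁-single (h ∘ suc) a λ c c≢a → z (suc c) (λ { refl → c≢a refl }) λ ())) (xor-same (h (suc a)))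
⨁-pair h (suc a) (suc b) a≢b e z rewrite z zero (λ ()) (λ ()) =
  ⨁-pair (h ∘ suc) a b (a≢b ∘ cong suc) e λ c c≢a c≢b → z (suc c) (λ { refl → c≢a refl }) (λ { refl → c≢b refl })

-- Off the diagonal, the terms at (i, j) and (j, i) are equal and cancel modulo 2.
⨁-diagonal : ∀ {n} (h : Fin n → Fin n → Bool) → (∀ i j → h i j ≡ h j i) →
             ⨁ (λ i → ⨁ (h i)) ≡ ⨁ (λ i → h i i)
⨁-diagonal {zero}  h s = refl
⨁-diagonal {suc n} h s = begin
  (h₀ xor A) xor ⨁ (λ i → h (suc i) zero xor ⨁ (λ j → h (suc i) (suc j)))
    ≡⟨ cong ((h₀ xor A) xor_) (∑-distrib-+ (λ i → h (suc i) zero) (λ i → ⨁ (λ j → h (suc i) (suc j)))) ⟩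
  (h₀ xor A) xor (⨁ (λ i → h (suc i) zero) xor ⨁ (λ i → ⨁ (λ j → h (suc i) (suc j))))
    ≡⟨ cong₂ (λ u v → (h₀ xor A) xor (u xor v)) (sum-cong-≗ λ i → s (suc i) zero) (⨁-diagonal (λ i j → h (suc i) (suc j)) λ i j → s (suc i) (suc j)) ⟩
  (h₀ xor A) xor (A xor B) ≡⟨ xor-assoc h₀ A (A xor B) ⟩
  h₀ xor (A xor (A xor B)) ≡⟨ cong (h₀ xor_) (xor-assoc A A B) ⟨
  h₀ xor ((A xor A) xor B) ≡⟨ cong (λ u → h₀ xor (u xor B)) (xor-same A) ⟩
  h₀ xor B ∎
  where
  open ≡-Reasoning
  h₀ = h zero zero
  A = ⨁ (λ j → h zero (suc j))
  B = ⨁ (λ i → h (suc i) (suc i))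

-- Lowering one entry of a vector

infixl 6 _[_]∸_
_[_]∸_ : ∀ {r} → Vec ℕ r → Fin r → ℕ → Vec ℕ r
x [ i ]∸ t = x [ i ]%= (_∸ t)

∸-swap : ∀ a s t → a ∸ s ∸ t ≡ a ∸ t ∸ s
∸-swap a s t = trans (∸-+-assoc a s t) (trans (cong (a ∸_) (+-comm s t)) (sym (∸-+-assoc a t s)))

module _ {r} (x : Vec ℕ r) where

  lookup-∸ : ∀ i t → lookup (x [ i ]∸ t) i ≡ lookup x i ∸ t
  lookup-∸ i t = lookup∘updateAt i x

  lookup-∸′ : ∀ {i j} t → j ≢ i → lookup (x [ i ]∸ t) j ≡ lookup x j
  lookup-∸′ {i} {j} t j≢i = lookup∘updateAt′ j i j≢i x

  lookup-∸-≤ : ∀ i t j → lookup (x [ i ]∸ t) j ≤ lookup x j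
  lookup-∸-≤ i t j with j ≟ᶠ i
  ... | yes refl = ≤-trans (≤-reflexive (lookup-∸ i t)) (m∸n≤m _ t)
  ... | no j≢i   = ≤-reflexive (lookup-∸′ t j≢i)

  ∸-commutes : ∀ i j s t → x [ i ]∸ s [ j ]∸ t ≡ x [ j ]∸ t [ i ]∸ s
  ∸-commutes i j s t with i ≟ᶠ j
  ... | no i≢j = updateAt-commutes j i (i≢j ∘ sym) x
  ... | yes refl = trans (updateAt-updateAt i x) (sym (updateAt-updateAt-local i x (∸-swap (lookup x i) t s)))

-- Beta-sets

record Valid {r} (x : Vec ℕ r) : Set where
  constructor valid
  field
    positive : ∀ i → 0 < lookup x i
    distinct : ∀ i j → lookup x i ≡ lookup x j → i ≡ j
open Valid

valid-or-defect : ∀ {r} (x : Vec ℕ r) → Valid x ⊎ (∃ λ i → lookup x i ≡ 0) ⊎ (∃ λ i → ∃ λ j → i ≢ j × lookup x i ≡ lookup x j)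
valid-or-defect x with any? (λ i → lookup x i ≟ 0) | any? (λ i → any? (λ j → ¬? (i ≟ᶠ j) ×-dec (lookup x i ≟ lookup x j)))
... | yes z | _ = inj₂ (inj₁ z)
... | no _  | yes c = inj₂ (inj₂ c)
... | no nz | no nc = inj₁ (valid (λ i → n≢0⇒n>0 λ e → nz (i , e)) dist)
  where
  dist : ∀ i j → lookup x i ≡ lookup x j → i ≡ j
  dist i j e with i ≟ᶠ j
  ... | yes p = p
  ... | no ne = contradiction (i , j , ne , e) nc

valid? : ∀ {r} (x : Vec ℕ r) → Dec (Valid x)
valid? x with valid-or-defect x
... | inj₁ v = yes v
... | inj₂ (inj₁ (i , e)) = no λ v → <⇒≢ (positive v i) (sym e)
... | inj₂ (inj₂ (i , j , i≢j , e)) = no λ v → i≢j (distinct v i j e)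

-- Hop operators and the Frobenius identity

hop : ∀ {r} → ℕ → (Vec ℕ r → Bool) → Vec ℕ r → Bool
hop t h x = ⨁ λ i → h (x [ i ]∸ t)

-- On a beta-set of size n, the parity of the number of tableaux. An entry 0 marks a dead vector: it stays 0 under truncated
-- subtraction, so lowering entries is an action of the commutative monoid ℕʳ and hop-hop holds without side conditions.
tab : ∀ {r} → ℕ → Vec ℕ r → Bool
tab zero    x = does (valid? x)
tab (suc n) x = hop 1 (tab n) x

-- The square of a sum of commuting operators in characteristic 2 is the sum of the squares; the
-- mixed terms cancel by `⨁-diagonal`.
hop-hop : ∀ {r} t (h : Vec ℕ r → Bool) x → hop t (hop t h) x ≡ hop (t + t) h x
hop-hop t h x = trans
  (⨁-diagonal (λ i j → h (x [ i ]∸ t [ j ]∸ t)) λ i j → cong h (∸-commutes x i j t t))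
  (sum-cong-≗ λ i → cong h (updateAt-updateAt-local i x (∸-+-assoc (lookup x i) t t)))

-- Repeated squaring by `hop-hop` merges `2 ^ k` unit steps into a single hop of that length.
tab-2^ : ∀ k {r} m (x : Vec ℕ r) → tab (2 ^ k + m) x ≡ hop (2 ^ k) (tab m) x
tab-2^ zero    m x = refl
tab-2^ (suc k) m x rewrite +-identityʳ (2 ^ k) | +-assoc (2 ^ k) (2 ^ k) m = begin
  tab (2 ^ k + (2 ^ k + m)) x          ≡⟨ tab-2^ k (2 ^ k + m) x ⟩
  hop (2 ^ k) (tab (2 ^ k + m)) x      ≡⟨ sum-cong-≗ (λ i → tab-2^ k m (x [ i ]∸ 2 ^ k)) ⟩
  hop (2 ^ k) (hop (2 ^ k) (tab m)) x  ≡⟨ hop-hop (2 ^ k) (tab m) x ⟩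
  hop (2 ^ k + 2 ^ k) (tab m) x        ∎
  where open ≡-Reasoning

-- Symmetry of `tab` and its vanishing on invalid vectors

⟨$⟩ʳ-injective : ∀ {n} (π : Permutation′ n) {i j} → π ⟨$⟩ʳ i ≡ π ⟨$⟩ʳ j → i ≡ j
⟨$⟩ʳ-injective π e = trans (sym (inverseˡ π)) (trans (cong (π ⟨$⟩ˡ_) e) (inverseˡ π))

valid-permute : ∀ {r} {x y : Vec ℕ r} (π : Permutation′ r) → (∀ k → lookup y k ≡ lookup x (π ⟨$⟩ʳ k)) → Valid x → Valid y
valid-permute π e (valid p d) = valid (λ i → subst (0 <_) (sym (e i)) (p _))
  λ i j q → ⟨$⟩ʳ-injective π (d _ _ (trans (sym (e i)) (trans q (e j))))

tab-permute : ∀ n {r} {x y : Vec ℕ r} (π : Permutation′ r) → (∀ k → lookup y k ≡ lookup x (π ⟨$⟩ʳ k)) → tab n y ≡ tab n x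
tab-permute zero {x = x} {y} π e with valid? x
... | yes v = dec-true (valid? y) (valid-permute π e v)
... | no ¬v = dec-false (valid? y) λ v → ¬v (valid-permute π⁻¹ e⁻¹ v)
  where
  π⁻¹ = flip π
  e⁻¹ : ∀ k → lookup x k ≡ lookup y (π⁻¹ ⟨$⟩ʳ k)
  e⁻¹ k = trans (cong (lookup x) (sym (inverseʳ π))) (sym (e (π ⟨$⟩ˡ k)))
tab-permute (suc n) {x = x} {y} π e = trans
  (sum-cong-≗ λ k → tab-permute n π (lowered k))
  (sym (sum-permute (λ i → tab n (x [ i ]∸ 1)) π))
  where
  lowered : ∀ k l → lookup (y [ k ]∸ 1) l ≡ lookup (x [ π ⟨$⟩ʳ k ]∸ 1) (π ⟨$⟩ʳ l)
  lowered k l with l ≟ᶠ k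
  ... | yes refl = trans (lookup-∸ y k 1) (trans (cong (_∸ 1) (e k)) (sym (lookup-∸ x _ 1)))
  ... | no l≢k = trans (lookup-∸′ y 1 l≢k) (trans (e l) (sym (lookup-∸′ x 1 (l≢k ∘ ⟨$⟩ʳ-injective π))))

tab-transpose : ∀ n {r} {x y : Vec ℕ r} i j → lookup y i ≡ lookup x j → lookup y j ≡ lookup x i →
                (∀ k → k ≢ i → k ≢ j → lookup y k ≡ lookup x k) → tab n y ≡ tab n x
tab-transpose n {x = x} {y} i j eᵢ eⱼ e = tab-permute n (transpose i j) transposed
  where
  transposed : ∀ k → lookup y k ≡ lookup x (transpose i j ⟨$⟩ʳ k)
  transposed k with k ≟ᶠ i
  ... | yes refl = eᵢ
  ... | no k≢i with k ≟ᶠ j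
  ...   | yes refl = eⱼ
  ...   | no k≢j = e k k≢i k≢j

-- A zero entry stays zero under every step. If two entries coincide, lowering one or the other
-- gives vectors that differ by a transposition, so these two terms cancel, and every other step
-- keeps the coincidence.
tab-invalid : ∀ n {r} (x : Vec ℕ r) → ¬ Valid x → tab n x ≡ false
tab-invalid zero    x ¬v = dec-false (valid? x) ¬v
tab-invalid (suc n) x ¬v with valid-or-defect x
... | inj₁ v = contradiction v ¬v
... | inj₂ (inj₁ (i , e)) = ⨁-zero _ λ c → tab-invalid n _ λ v →
        n≮0 (<-≤-trans (positive v i) (≤-trans (lookup-∸-≤ x c 1 i) (≤-reflexive e)))
... | inj₂ (inj₂ (i , j , i≢j , e)) = ⨁-pair _ i j i≢j
        (tab-transpose n i j
          (trans (lookup-∸ x i 1) (trans (cong (_∸ 1) e) (sym (lookup-∸ x j 1))))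
          (trans (lookup-∸′ x 1 (i≢j ∘ sym)) (trans (sym e) (sym (lookup-∸′ x 1 i≢j))))
          λ k k≢i k≢j → trans (lookup-∸′ x 1 k≢i) (sym (lookup-∸′ x 1 k≢j)))
        λ c c≢i c≢j → tab-invalid n _ λ v → i≢j (distinct v i j
          (trans (lookup-∸′ x 1 (c≢i ∘ sym)) (trans e (sym (lookup-∸′ x 1 (c≢j ∘ sym))))))

tab-valid : ∀ n {r} {x : Vec ℕ r} → tab n x ≡ true → Valid x
tab-valid n {x = x} e with valid? x
... | yes v = v
... | no ¬v = contradiction (tab-invalid n x ¬v) (true≢false e)

-- Totals of beta-sets; the least one, `base r`, is attained by r empty rows

base : ℕ → ℕ
base zero    = 0
base (suc r) = suc r + base r

total : ∀ {r} → Vec ℕ r → ℕ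
total x = ∑ (lookup x)

minimum : ∀ {n} (g : Fin (suc n) → ℕ) → ∃ λ p → ∀ i → g p ≤ g i
minimum {zero} g = zero , λ { zero → ≤-refl }
minimum {suc n} g with minimum (g ∘ suc)
... | p , m with ≤-total (g zero) (g (suc p))
...   | inj₁ le = zero , λ { zero → ≤-refl ; (suc i) → ≤-trans le (m i) }
...   | inj₂ ge = suc p , λ { zero → ge ; (suc i) → m i }

∑-pred : ∀ {n} (g : Fin n → ℕ) → (∀ i → 0 < g i) → ∑ g ≡ n + ∑ (λ i → pred (g i))
∑-pred {zero}  g p = refl
∑-pred {suc n} g p with g zero | p zero
... | suc a | _ = cong suc (begin
  a + ∑ (g ∘ suc)      ≡⟨ cong (a +_) (∑-pred (g ∘ suc) (p ∘ suc)) ⟩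
  a + (n + S)          ≡⟨ +-assoc a n S ⟨
  a + n + S            ≡⟨ cong (_+ S) (+-comm a n) ⟩
  n + a + S            ≡⟨ +-assoc n a S ⟩
  n + (a + S)          ∎)
  where
  open ≡-Reasoning
  S = ∑ (λ i → pred (g (suc i)))

-- Remove the minimum and lower all the other values by one.
∑-distinct : ∀ {n} (g : Fin n → ℕ) → (∀ i → 0 < g i) → (∀ i j → g i ≡ g j → i ≡ j) → base n ≤ ∑ g
∑-distinct {zero}  g p d = z≤n
∑-distinct {suc n} g p d with minimum g
... | q , m = begin
  suc n + base n     ≤⟨ +-monoʳ-≤ (suc n) (∑-distinct (pred ∘ rest) pos dist) ⟩
  suc n + ∑ (pred ∘ rest) ≡⟨ cong suc (sym (∑-pred rest λ i → p _)) ⟩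
  suc (∑ rest)       ≤⟨ +-monoˡ-≤ (∑ rest) (p q) ⟩
  g q + ∑ rest       ≡⟨ ∑-remove g ⟨
  ∑ g ∎
  where
  open ≤-Reasoning
  rest = g ∘ punchIn q
  above : ∀ i → g q < rest i
  above i = ≤∧≢⇒< (m _) λ e → punchInᵢ≢i q i (sym (d _ _ e))
  pos : ∀ i → 0 < pred (rest i)
  pos i = pred-mono-≤ (≤-trans (s≤s (p q)) (above i))
  dist : ∀ i j → pred (rest i) ≡ pred (rest j) → i ≡ j
  dist i j e = punchIn-injective q i j (d _ _ (pred-inj (p _) (p _) e))
    where
    pred-inj : ∀ {a b} → 0 < a → 0 < b → pred a ≡ pred b → a ≡ b
    pred-inj {suc a} {suc b} _ _ refl = refl

total-∸ : ∀ {r} (x : Vec ℕ r) i {t} → t ≤ lookup x i → total (x [ i ]∸ t) + t ≡ total x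
total-∸ (a ∷ x) zero {t} le = begin
  a ∸ t + total x + t   ≡⟨ +-assoc (a ∸ t) (total x) t ⟩
  a ∸ t + (total x + t) ≡⟨ cong (a ∸ t +_) (+-comm (total x) t) ⟩
  a ∸ t + (t + total x) ≡⟨ +-assoc (a ∸ t) t (total x) ⟨
  a ∸ t + t + total x   ≡⟨ cong (_+ total x) (m∸n+n≡m le) ⟩
  a + total x           ∎
  where open ≡-Reasoning
total-∸ (a ∷ x) (suc i) {t} le = trans (+-assoc a _ t) (cong (a +_) (total-∸ x i le))

base≤total : ∀ {r} {x : Vec ℕ r} → Valid x → base r ≤ total x
base≤total (valid p d) = ∑-distinct _ p d

-- Legal moves and the obstruction to them

module _ {r} {x : Vec ℕ r} {i : Fin r} {t : ℕ} (v : Valid (x [ i ]∸ t)) where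

  ∸-room : t < lookup x i
  ∸-room = m∸n≢0⇒n<m λ e → <⇒≢ (positive v i) (sym (trans (lookup-∸ x i t) e))

  total-∸-valid : total (x [ i ]∸ t) + t ≡ total x
  total-∸-valid = total-∸ x i (<⇒≤ ∸-room)

∸-free : ∀ {r} {x : Vec ℕ r} {i} t → Valid (x [ i ]∸ t) → ∀ {c} → c ≢ i → lookup x c ≢ lookup x i ∸ t
∸-free {x = x} {i} t v c≢i e = c≢i (distinct v _ _ (trans (lookup-∸′ x t c≢i) (trans e (sym (lookup-∸ x i t)))))

-- With `t < lookup x j` the lowered entry stays positive, so only an entry already sitting at the
-- target can spoil validity.
move : ∀ {r} {x : Vec ℕ r} j {t} → Valid x → t < lookup x j →
       Valid (x [ j ]∸ t) ⊎ (∃ λ c → c ≢ j × lookup x c ≡ lookup x j ∸ t)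
move {x = x} j {t} v t<xⱼ with any? (λ c → ¬? (c ≟ᶠ j) ×-dec (lookup x c ≟ lookup x j ∸ t))
... | yes p = inj₂ p
... | no ¬p = inj₁ (valid pos dist)
  where
  pos : ∀ i → 0 < lookup (x [ j ]∸ t) i
  pos i with i ≟ᶠ j
  ... | yes refl = subst (0 <_) (sym (lookup-∸ x j t)) (m<n⇒0<n∸m t<xⱼ)
  ... | no i≢j = subst (0 <_) (sym (lookup-∸′ x t i≢j)) (positive v i)
  dist : ∀ a b → lookup (x [ j ]∸ t) a ≡ lookup (x [ j ]∸ t) b → a ≡ b
  dist a b e with a ≟ᶠ j | b ≟ᶠ j
  ... | yes refl | yes refl = refl
  ... | yes refl | no b≢j = contradiction (b , b≢j , trans (sym (lookup-∸′ x t b≢j)) (trans (sym e) (lookup-∸ x j t))) ¬p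
  ... | no a≢j | yes refl = contradiction (a , a≢j , trans (sym (lookup-∸′ x t a≢j)) (trans e (lookup-∸ x j t))) ¬p
  ... | no a≢j | no b≢j = distinct v a b (trans (sym (lookup-∸′ x t a≢j)) (trans e (lookup-∸′ x t b≢j)))

∸-suc : ∀ {a b t} → t < a → t < b → a ∸ t ≡ b ∸ t ∸ 1 → b ≡ suc a
∸-suc {a} {b} {t} t<a t<b e = ∸-cancelʳ-≡ (<⇒≤ t<b) (≤-trans (<⇒≤ t<a) (n≤1+n a)) (begin
  b ∸ t             ≡⟨ m+[n∸m]≡n {1} (m<n⇒0<n∸m t<b) ⟨
  suc (b ∸ t ∸ 1)   ≡⟨ cong suc e ⟨
  suc (a ∸ t)       ≡⟨ +-∸-assoc 1 (<⇒≤ t<a) ⟨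
  suc a ∸ t         ∎)
  where open ≡-Reasoning

-- Beta-sets with room for only one hop by t

module Core {r} {x : Vec ℕ r} (t : ℕ) (vx : Valid x) (small : total x < base r + (t + t))
            {i : Fin r} (vy : Valid (x [ i ]∸ t)) where

  y = x [ i ]∸ t

  -- Two hops by t would push the total below `base r`, the least total of a valid vector. The
  -- conclusion is an arbitrary type so that it can close any branch.
  too-small : ∀ {z : Vec ℕ r} → Valid z → total z + t + t ≤ total x → ∀ {A : Set} → A
  too-small {z} vz le = contradiction (begin-strict
    total x            <⟨ small ⟩
    base r + (t + t)   ≡⟨ +-assoc (base r) t t ⟨
    base r + t + t     ≤⟨ +-monoˡ-≤ t (+-monoˡ-≤ t (base≤total vz)) ⟩
    total z + t + t    ≤⟨ le ⟩
    total x            ∎) (<-irrefl refl)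
    where open ≤-Reasoning

  -- A hop of j after the hop of i would be a second one, so some entry occupies its target. That
  -- entry is not the lowered i, since then i and j would have had equal values in x.
  blocked : ∀ {j} → j ≢ i → t < lookup x j → ∃ λ c → c ≢ i × c ≢ j × lookup x c ≡ lookup x j ∸ t
  blocked {j} j≢i t<xⱼ with move j vy (subst (t <_) (sym (lookup-∸′ x t j≢i)) t<xⱼ)
  ... | inj₁ v = too-small v (≤-reflexive (trans (cong (_+ t) (total-∸-valid v)) (total-∸-valid vy)))
  ... | inj₂ (c , c≢j , e) with c ≟ᶠ i
  ...   | no c≢i = c , c≢i , c≢j , trans (sym (lookup-∸′ x t c≢i)) (trans e (cong (_∸ t) (lookup-∸′ x t j≢i)))
  ...   | yes refl = contradiction (distinct vx _ _ (∸-cancelʳ-≡ (<⇒≤ t<xⱼ) (<⇒≤ (∸-room vy))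
                       (trans (cong (_∸ t) (sym (lookup-∸′ x t j≢i))) (trans (sym e) (lookup-∸ x i t))))) j≢i

  -- Otherwise the entries i, j and c could all be lowered, by 2t + 1 in total.
  neighbour : ∀ {j c} → j ≢ i → c ≢ i → c ≢ j → t < lookup x j → lookup x c ≡ lookup x j ∸ t → 1 < lookup x c →
              (∀ d → d ≢ i → d ≢ j → d ≢ c → lookup x d ≢ lookup x c ∸ 1) → lookup x j ≡ suc (lookup x i)
  neighbour {j} {c} j≢i c≢i c≢j t<xⱼ e 1<xc free
    with move c vy (subst (1 <_) (sym (lookup-∸′ x t c≢i)) 1<xc)
  ... | inj₂ (d , d≢c , f) = collide (d ≟ᶠ i) (d ≟ᶠ j)
    where
    f′ : lookup y d ≡ lookup x c ∸ 1
    f′ = trans f (cong (_∸ 1) (lookup-∸′ x t c≢i))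
    collide : Dec (d ≡ i) → Dec (d ≡ j) → lookup x j ≡ suc (lookup x i)
    -- The one case that survives: the lowered entry i sits directly below c, and undoing the two
    -- shifts by t puts j directly above i.
    collide (yes refl) _ = ∸-suc (∸-room vy) t<xⱼ (trans (sym (lookup-∸ x i t)) (trans f′ (cong (_∸ 1) e)))
    collide (no d≢i) (no d≢j) = contradiction (trans (sym (lookup-∸′ x t d≢i)) f′) (free d d≢i d≢j d≢c)
    collide (no d≢i) (yes refl) = contradiction (begin-strict
      lookup x d     ≡⟨ trans (sym (lookup-∸′ x t d≢i)) f′ ⟩
      lookup x c ∸ 1 <⟨ ∸-monoʳ-< {lookup x c} {1} {0} ≤-refl (<⇒≤ 1<xc) ⟩
      lookup x c     ≡⟨ e ⟩
      lookup x d ∸ t ≤⟨ m∸n≤m _ t ⟩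
      lookup x d     ∎) (<-irrefl refl)
      where open ≤-Reasoning
  -- Once c has stepped down, its old value `lookup x j ∸ t` is vacant, so j can hop there, against
  -- the bound on the total.
  ... | inj₁ vw = lower-j (move j vw (subst (t <_) (sym wⱼ) t<xⱼ))
    where
    w = y [ c ]∸ 1
    wⱼ : lookup w j ≡ lookup x j
    wⱼ = trans (lookup-∸′ y 1 (c≢j ∘ sym)) (lookup-∸′ x t j≢i)
    lower-j : Valid (w [ j ]∸ t) ⊎ (∃ λ d → d ≢ j × lookup w d ≡ lookup w j ∸ t) → lookup x j ≡ suc (lookup x i)
    lower-j (inj₁ v) = too-small v (begin
      total (w [ j ]∸ t) + t + t ≡⟨ cong (_+ t) (total-∸-valid v) ⟩
      total w + t                ≤⟨ +-monoˡ-≤ t (≤-trans (m≤m+n _ 1) (≤-reflexive (total-∸-valid vw))) ⟩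
      total y + t                ≡⟨ total-∸-valid vy ⟩
      total x                    ∎)
      where open ≤-Reasoning
    lower-j (inj₂ (d , d≢j , f)) = collide (d ≟ᶠ c) (d ≟ᶠ i)
      where
      f′ : lookup w d ≡ lookup x j ∸ t
      f′ = trans f (cong (_∸ t) wⱼ)
      collide : Dec (d ≡ c) → Dec (d ≡ i) → lookup x j ≡ suc (lookup x i)
      collide (yes refl) _ = contradiction
        (trans (cong (_∸ 1) (sym (lookup-∸′ x t c≢i))) (trans (sym (lookup-∸ y d 1)) (trans f′ (sym e))))
        (<⇒≢ (∸-monoʳ-< {lookup x d} {1} {0} ≤-refl (<⇒≤ 1<xc)))
      collide (no d≢c) (yes refl) = contradiction
        (distinct vx _ _ (∸-cancelʳ-≡ (<⇒≤ t<xⱼ) (<⇒≤ (∸-room vy)) (trans (sym f′) (trans (lookup-∸′ y 1 d≢c) (lookup-∸ x i t))))) j≢i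
      collide (no d≢c) (no d≢i) = contradiction
        (distinct vx _ _ (trans (sym (lookup-∸′ x t d≢i)) (trans (sym (lookup-∸′ y 1 d≢c)) (trans f′ (sym e))))) d≢c

  -- In x the hop of j is blocked by some c, so the step at a must have cleared the way. Either a is
  -- c, or a is j itself; in the latter case `neighbour` puts j directly above i, so that the step
  -- of j would collide with i.
  hop-after-step : ∀ {a j} → Valid (x [ a ]∸ 1) → Valid (x [ a ]∸ 1 [ j ]∸ t) → j ≢ i →
                   a ≢ i × a ≢ j × lookup x a ≡ lookup x j ∸ t × lookup x j ≡ suc (lookup x i)
  hop-after-step {a} {j} va vj j≢i = cases (blocked j≢i t<xⱼ)
    where
    t<xⱼ : t < lookup x j
    t<xⱼ = <-≤-trans (∸-room vj) (lookup-∸-≤ x a 1 j)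
    cases : (∃ λ c → c ≢ i × c ≢ j × lookup x c ≡ lookup x j ∸ t) →
            a ≢ i × a ≢ j × lookup x a ≡ lookup x j ∸ t × lookup x j ≡ suc (lookup x i)
    cases (c , c≢i , c≢j , e) with c ≟ᶠ a | a ≟ᶠ j
    ... | yes refl | _ = c≢i , c≢j , e , neighbour j≢i c≢i c≢j t<xⱼ e (∸-room va) (λ d _ _ d≢c → ∸-free 1 va d≢c)
    ... | no c≢a | no a≢j = contradiction
      (trans (lookup-∸′ x 1 c≢a) (trans e (cong (_∸ t) (sym (lookup-∸′ x 1 (a≢j ∘ sym)))))) (∸-free t vj c≢j)
    ... | no c≢a | yes refl = contradiction
      (sym (cong (_∸ 1) (neighbour j≢i c≢i c≢j t<xⱼ e 1<xc free))) (∸-free 1 va (j≢i ∘ sym))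
      where
      1<xc : 1 < lookup x c
      1<xc = m∸n≢0⇒n<m λ z → <⇒≢ (m<n⇒0<n∸m {t} (∸-room vj))
        (sym (trans (cong (_∸ t) (lookup-∸ x j 1)) (trans (∸-swap (lookup x j) 1 t) (trans (cong (_∸ 1) (sym e)) z))))
      -- After its step and its hop, j lands on `lookup x c ∸ 1`; validity of that vector keeps all
      -- other entries away from this value.
      free : ∀ d → d ≢ i → d ≢ j → d ≢ c → lookup x d ≢ lookup x c ∸ 1
      free d _ d≢j _ f = ∸-free t vj d≢j (begin
        lookup (x [ j ]∸ 1) d     ≡⟨ lookup-∸′ x 1 d≢j ⟩
        lookup x d                ≡⟨ f ⟩
        lookup x c ∸ 1            ≡⟨ cong (_∸ 1) e ⟩
        lookup x j ∸ t ∸ 1        ≡⟨ ∸-swap (lookup x j) t 1 ⟩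
        lookup x j ∸ 1 ∸ t        ≡⟨ cong (_∸ t) (lookup-∸ x j 1) ⟨
        lookup (x [ j ]∸ 1) j ∸ t ∎)
        where open ≡-Reasoning

  -- The two vectors differ by a 3-cycle of the entries a, j and i.
  tab-exchange : ∀ n {a j} → j ≢ i → a ≢ i → a ≢ j → lookup x a ≡ lookup x j ∸ t → lookup x j ≡ suc (lookup x i) →
                 tab n (x [ a ]∸ 1 [ j ]∸ t) ≡ tab n (y [ j ]∸ 1)
  tab-exchange n {a} {j} j≢i a≢i a≢j e f = trans (sym q≡p) (sym z≡q)
    where
    i≢j = j≢i ∘ sym
    p = x [ a ]∸ 1 [ j ]∸ t
    z = y [ j ]∸ 1
    -- The 3-cycle is split into two transpositions: `q` is `p` with the entries i and j
    -- interchanged, and interchanging i and a in `q` gives `z`.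
    p₁ = p [ i ]≔ lookup x a
    q = p₁ [ j ]≔ lookup x i
    pᵢ : lookup p i ≡ lookup x i
    pᵢ = trans (lookup-∸′ (x [ a ]∸ 1) t i≢j) (lookup-∸′ x 1 (a≢i ∘ sym))
    pⱼ : lookup p j ≡ lookup x a
    pⱼ = trans (lookup-∸ (x [ a ]∸ 1) j t) (trans (cong (_∸ t) (lookup-∸′ x 1 (a≢j ∘ sym))) (sym e))
    qᵢ : lookup q i ≡ lookup x a
    qᵢ = trans (lookup∘updateAt′ i j i≢j p₁) (lookup∘updateAt i p)
    q′ : ∀ k → k ≢ i → k ≢ j → lookup q k ≡ lookup p k
    q′ k k≢i k≢j = trans (lookup∘updateAt′ k j k≢j p₁) (lookup∘updateAt′ k i k≢i p)
    p′ : ∀ {k} → k ≢ j → lookup p k ≡ lookup (x [ a ]∸ 1) k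
    p′ = lookup-∸′ (x [ a ]∸ 1) t
    z′ : ∀ {k} → k ≢ j → lookup z k ≡ lookup y k
    z′ = lookup-∸′ y 1
    q≡p : tab n q ≡ tab n p
    q≡p = tab-transpose n i j (trans qᵢ (sym pⱼ)) (trans (lookup∘updateAt j p₁) (sym pᵢ)) q′
    xₐ : lookup x a ≡ suc (lookup x i ∸ t)
    xₐ = trans e (trans (cong (_∸ t) f) (+-∸-assoc 1 {o = t} (<⇒≤ (∸-room vy))))
    zᵢ : lookup z i ≡ lookup q a
    zᵢ = begin
      lookup z i              ≡⟨ z′ i≢j ⟩
      lookup y i              ≡⟨ lookup-∸ x i t ⟩
      lookup x i ∸ t          ≡⟨ cong (_∸ 1) xₐ ⟨
      lookup x a ∸ 1          ≡⟨ lookup-∸ x a 1 ⟨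
      lookup (x [ a ]∸ 1) a   ≡⟨ p′ a≢j ⟨
      lookup p a              ≡⟨ q′ a a≢i a≢j ⟨
      lookup q a              ∎
      where open ≡-Reasoning
    zₐ : lookup z a ≡ lookup q i
    zₐ = trans (z′ a≢j) (trans (lookup-∸′ x t a≢i) (sym qᵢ))
    zₖ : ∀ k → k ≢ i → k ≢ a → lookup z k ≡ lookup q k
    zₖ k k≢i k≢a with k ≟ᶠ j
    ... | no k≢j = trans (z′ k≢j) (trans (lookup-∸′ x t k≢i) (sym (trans (q′ k k≢i k≢j) (trans (p′ k≢j) (lookup-∸′ x 1 k≢a)))))
    ... | yes refl = trans (lookup-∸ y j 1) (trans (cong (_∸ 1) (trans (lookup-∸′ x t j≢i) f)) (sym (lookup∘updateAt j p₁)))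
    z≡q : tab n z ≡ tab n q
    z≡q = tab-transpose n i a zᵢ zₐ zₖ

-- Uniqueness of the odd step, by descent along powers of two

UniqueStep : ∀ {r} → ℕ → Vec ℕ r → Set
UniqueStep n x = ∀ {a b} → tab n (x [ a ]∸ 1) ≡ true → tab n (x [ b ]∸ 1) ≡ true → a ≡ b

-- With nothing left after the hop, x is a hook shape and has at most two removable cells; parity excludes both being odd.
hook-unique : ∀ {r} {x : Vec ℕ r} {i} t n → total x ≡ base r + t → Valid x → Valid (x [ i ]∸ t) →
              tab (suc n) x ≡ true → UniqueStep n x
hook-unique {r} {x} {i} t n size vx vy odd {a} {b} oa ob = cases (a ≟ᶠ i) (b ≟ᶠ i)
  where
  y = x [ i ]∸ t
  total-y : total y ≡ base r
  total-y = +-cancelʳ-≡ t _ _ (trans (total-∸-valid vy) size)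
  -- The total of `y` is minimal, so c cannot step down in `y`. As it can in x, the obstacle is the
  -- lowered entry i, and this fixes the value of entry c.
  other : ∀ {c} → tab n (x [ c ]∸ 1) ≡ true → c ≢ i → lookup x c ∸ 1 ≡ lookup x i ∸ t
  other {c} oc c≢i with move c vy (subst (1 <_) (sym (lookup-∸′ x t c≢i)) (∸-room (tab-valid n oc)))
  ... | inj₁ v = contradiction (begin-strict
    base r             ≤⟨ base≤total v ⟩
    total (y [ c ]∸ 1) <⟨ m<m+n _ {1} (s≤s z≤n) ⟩
    total (y [ c ]∸ 1) + 1 ≡⟨ total-∸-valid v ⟩
    total y            ≡⟨ total-y ⟩
    base r             ∎) (<-irrefl refl)
    where open ≤-Reasoning
  ... | inj₂ (d , d≢c , e) with d ≟ᶠ i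
  ...   | yes refl = trans (cong (_∸ 1) (sym (lookup-∸′ x t c≢i))) (trans (sym e) (lookup-∸ x i t))
  ...   | no d≢i = contradiction (trans (sym (lookup-∸′ x t d≢i)) (trans e (cong (_∸ 1) (lookup-∸′ x t c≢i)))) (∸-free 1 (tab-valid n oc) d≢c)
  same : ∀ {c d} → tab n (x [ c ]∸ 1) ≡ true → c ≢ i → tab n (x [ d ]∸ 1) ≡ true → d ≢ i → c ≡ d
  same oc c≢i od d≢i = distinct vx _ _ (∸-cancelʳ-≡ {1} (positive vx _) (positive vx _) (trans (other oc c≢i) (sym (other od d≢i))))
  not-both : ∀ {c} → tab n (x [ i ]∸ 1) ≡ true → tab n (x [ c ]∸ 1) ≡ true → c ≢ i → ∀ {A : Set} → A
  not-both {c} oi oc c≢i = contradiction (⨁-pair _ i c (c≢i ∘ sym) (trans oi (sym oc)) others) (true≢false odd)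
    where
    others : ∀ d → d ≢ i → d ≢ c → tab n (x [ d ]∸ 1) ≡ false
    others d d≢i d≢c with tab n (x [ d ]∸ 1) in od
    ... | false = refl
    ... | true  = contradiction (same od d≢i oc c≢i) d≢c
  cases : Dec (a ≡ i) → Dec (b ≡ i) → a ≡ b
  cases (yes refl) (yes refl) = refl
  cases (no a≢i)   (no b≢i)   = same oa a≢i ob b≢i
  cases (yes refl) (no b≢i)   = not-both oa ob b≢i
  cases (no a≢i)   (yes refl) = not-both ob oa a≢i

module _ k {r} {x : Vec ℕ r} {m : ℕ} (size : total x ≡ base r + (2 ^ k + suc m)) (small : suc m < 2 ^ k)
         (vx : Valid x) {i : Fin r} (vy : Valid (x [ i ]∸ 2 ^ k)) where

  private t = 2 ^ k

  small-total : total x < base r + (t + t)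
  small-total = ≤-<-trans (≤-reflexive size) (+-monoʳ-< (base r) (+-monoʳ-< t small))

  open Core t vx small-total vy

  -- An odd lower neighbour of x yields one of y; the index changes only in the second alternative.
  transfer : ∀ {a} → tab (t + m) (x [ a ]∸ 1) ≡ true →
             ∃ λ c → tab m (y [ c ]∸ 1) ≡ true × (c ≡ a ⊎ (lookup x a ≡ lookup x c ∸ t × lookup x c ≡ suc (lookup x i)))
  -- By Frobenius the odd step at a is followed by an odd hop, at some j. If j is i, step and hop
  -- commute; otherwise `tab-exchange` replaces the pair by the hop of i and a step of j.
  transfer {a} oa with ⨁-true (λ j → tab m (x [ a ]∸ 1 [ j ]∸ t)) (trans (sym (tab-2^ k m (x [ a ]∸ 1))) oa)
  ... | j , oj with j ≟ᶠ i
  ...   | yes refl = a , trans (cong (tab m) (∸-commutes x j a t 1)) oj , inj₁ refl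
  ...   | no j≢i with hop-after-step (tab-valid (t + m) oa) (tab-valid m oj) j≢i
  ...     | a≢i , a≢j , e , f = j , trans (sym (tab-exchange m j≢i a≢i a≢j e f)) oj , inj₂ (e , f)

  -- Both odd steps transfer to the same c. If the index changed for both, a and b carry the same
  -- value `lookup x c ∸ t`. If it changed for only one, c lies directly above i and yet steps down
  -- in x, a collision.
  step-unique : UniqueStep m y → UniqueStep (t + m) x
  step-unique IH {a} {b} oa ob with transfer oa | transfer ob
  ... | c , oc , ca | d , od , db with IH oc od
  ...   | refl = cases ca db
    where
    clash : ∀ {e} → Valid (x [ e ]∸ 1) → lookup x e ≡ suc (lookup x i) → ∀ {A : Set} → A
    clash {e} ve f = contradiction (sym (cong (_∸ 1) f)) (∸-free 1 ve λ { refl → 1+n≢n (sym f) })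
    cases : c ≡ a ⊎ (lookup x a ≡ lookup x c ∸ t × lookup x c ≡ suc (lookup x i)) →
            c ≡ b ⊎ (lookup x b ≡ lookup x c ∸ t × lookup x c ≡ suc (lookup x i)) → a ≡ b
    cases (inj₁ refl) (inj₁ refl) = refl
    cases (inj₂ (e , _)) (inj₂ (e′ , _)) = distinct vx _ _ (trans e (sym e′))
    cases (inj₁ refl) (inj₂ (_ , f)) = clash (tab-valid (t + m) oa) f
    cases (inj₂ (_ , f)) (inj₁ refl) = clash (tab-valid (t + m) ob) f

-- The exponent decreases until `2 ^ k` is the largest power of two not exceeding `suc n`. One hop
-- by it leaves a remainder below `2 ^ k`: remainder zero is the hook case, and otherwise the same
-- exponent bounds the recursive call.
unique-below : ∀ k {r} n (x : Vec ℕ r) → suc n < 2 ^ k → total x ≡ base r + suc n → tab (suc n) x ≡ true → UniqueStep n x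
unique-below zero    n x (s≤s ()) size odd
unique-below (suc k) {r} n x n< size odd with suc n <? 2 ^ k
... | yes lt = unique-below k n x lt size odd
... | no  ge = split (suc n ∸ t) (m+[n∸m]≡n (≮⇒≥ ge))
  where
  t = 2 ^ k
  split : ∀ m → t + m ≡ suc n → UniqueStep n x
  split m eq with ⨁-true (λ i → tab m (x [ i ]∸ t)) (trans (sym (tab-2^ k m x)) (subst (λ u → tab u x ≡ true) (sym eq) odd))
  split zero eq | i , oi =
    hook-unique t n (trans size (cong (base r +_) (sym (trans (sym (+-identityʳ t)) eq)))) (tab-valid (suc n) odd) (tab-valid 0 oi) odd
  split (suc m) eq | i , oi with suc-injective (trans (sym (+-suc t m)) eq)
  ... | refl = step-unique k size′ small (tab-valid (suc n) odd) vy (unique-below k m (x [ i ]∸ t) small size-y oi)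
    where
    vy = tab-valid (suc m) oi
    size′ : total x ≡ base r + (t + suc m)
    size′ = trans size (cong (base r +_) (sym eq))
    small : suc m < t
    small = +-cancelˡ-< t (suc m) t (subst₂ _<_ (sym eq) (cong (t +_) (+-identityʳ t)) n<)
    size-y : total (x [ i ]∸ t) ≡ base r + suc m
    size-y = +-cancelʳ-≡ t _ _ (begin
      total (x [ i ]∸ t) + t ≡⟨ total-∸-valid vy ⟩
      total x                ≡⟨ size′ ⟩
      base r + (t + suc m)   ≡⟨ cong (base r +_) (+-comm t (suc m)) ⟩
      base r + (suc m + t)   ≡⟨ +-assoc (base r) (suc m) t ⟨
      base r + suc m + t     ∎)
      where open ≡-Reasoning

n<2^n : ∀ n → n < 2 ^ n
n<2^n zero    = s≤s z≤n
n<2^n (suc n) = +-mono-≤ (m^n>0 2 n) (subst (suc n ≤_) (sym (+-identityʳ (2 ^ n))) (n<2^n n))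

tab-unique : ∀ {r} n (x : Vec ℕ r) → total x ≡ base r + suc n → tab (suc n) x ≡ true → UniqueStep n x
tab-unique n x = unique-below (suc n) n x (n<2^n (suc n))

-- Independence of the number of rows: deleting an empty last row

data Shift : ∀ {n} → Vec ℕ (suc n) → Vec ℕ n → Set where
  last : Shift (1 ∷ []) []
  _∷_  : ∀ {n} a {x : Vec ℕ (suc n)} {y} → Shift x y → Shift (suc a ∷ x) (a ∷ y)

final : ∀ {n} {x : Vec ℕ (suc n)} {y} → Shift x y → Fin (suc n)
final last    = zero
final (a ∷ s) = suc (final s)

embed : ∀ {n} {x : Vec ℕ (suc n)} {y} → Shift x y → Fin n → Fin (suc n)
embed (a ∷ s) zero    = zero
embed (a ∷ s) (suc i) = suc (embed s i)

lookup-final : ∀ {n} {x : Vec ℕ (suc n)} {y} (s : Shift x y) → lookup x (final s) ≡ 1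
lookup-final last    = refl
lookup-final (a ∷ s) = lookup-final s

lookup-embed : ∀ {n} {x : Vec ℕ (suc n)} {y} (s : Shift x y) i → lookup x (embed s i) ≡ suc (lookup y i)
lookup-embed (a ∷ s) zero    = refl
lookup-embed (a ∷ s) (suc i) = lookup-embed s i

embed≢final : ∀ {n} {x : Vec ℕ (suc n)} {y} (s : Shift x y) i → embed s i ≢ final s
embed≢final (a ∷ s) zero    ()
embed≢final (a ∷ s) (suc i) e with embed s i | final s | embed≢final s i
embed≢final (a ∷ s) (suc i) refl | _ | _ | ne = ne refl

embed-injective : ∀ {n} {x : Vec ℕ (suc n)} {y} (s : Shift x y) i j → embed s i ≡ embed s j → i ≡ j
embed-injective (a ∷ s) zero    zero    e = refl
embed-injective (a ∷ s) (suc i) (suc j) e = cong suc (embed-injective s i j (sucᶠ-injective e))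

data View {n} {x : Vec ℕ (suc n)} {y} (s : Shift x y) : Fin (suc n) → Set where
  is-final : View s (final s)
  is-embed : ∀ i → View s (embed s i)

view : ∀ {n} {x : Vec ℕ (suc n)} {y} (s : Shift x y) k → View s k
view last    zero = is-final
view (a ∷ s) zero = is-embed zero
view (a ∷ s) (suc k) with view s k
... | is-final   = is-final
... | is-embed i = is-embed (suc i)

⨁-embed : ∀ {n} {x : Vec ℕ (suc n)} {y} (s : Shift x y) (h : Fin (suc n) → Bool) → h (final s) ≡ false → ⨁ h ≡ ⨁ (h ∘ embed s)
⨁-embed last    h e rewrite e = refl
⨁-embed (a ∷ s) h e = cong (h zero xor_) (⨁-embed s (h ∘ suc) e)

Shift-∸ : ∀ {n} {x : Vec ℕ (suc n)} {y} (s : Shift x y) i → 0 < lookup y i → Shift (x [ embed s i ]∸ 1) (y [ i ]∸ 1)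
Shift-∸ (suc a ∷ s) zero    _ = a ∷ s
Shift-∸ (a ∷ s)     (suc i) p = a ∷ Shift-∸ s i p

module _ {n} {x : Vec ℕ (suc n)} {y : Vec ℕ n} (s : Shift x y) where

  Shift-valid : Valid y → Valid x
  Shift-valid (valid p d) = valid pos dist
    where
    pos : ∀ k → 0 < lookup x k
    pos k with view s k
    ... | is-final   = ≤-reflexive (sym (lookup-final s))
    ... | is-embed i = subst (0 <_) (sym (lookup-embed s i)) (s≤s z≤n)
    dist : ∀ k l → lookup x k ≡ lookup x l → k ≡ l
    dist k l e with view s k | view s l
    ... | is-final   | is-final   = refl
    ... | is-embed i | is-embed j = cong (embed s) (d i j (suc-injective (trans (sym (lookup-embed s i)) (trans e (lookup-embed s j)))))
    ... | is-final   | is-embed j = contradiction (suc-injective (trans (sym (lookup-final s)) (trans e (lookup-embed s j)))) (<⇒≢ (p j))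
    ... | is-embed i | is-final   = contradiction (suc-injective (trans (sym (lookup-final s)) (trans (sym e) (lookup-embed s i)))) (<⇒≢ (p i))

  Shift-valid⁻¹ : Valid x → Valid y
  Shift-valid⁻¹ (valid p d) = valid
    (λ i → n≢0⇒n>0 λ e → embed≢final s i (d _ _ (trans (lookup-embed s i) (trans (cong suc e) (sym (lookup-final s))))))
    (λ i j e → embed-injective s i j (d _ _ (trans (lookup-embed s i) (trans (cong suc e) (sym (lookup-embed s j))))))

-- Deleting an empty last row removes the entry 1 from the beta-set and lowers all other entries by
-- one. A step of that entry 1 produces a dead vector, so the remaining summands match one to one.
tab-Shift : ∀ n {r} {x : Vec ℕ (suc r)} {y} → Shift x y → tab n x ≡ tab n y
-- Validity of `y` is decided first because `Shift-∸` needs positive entries of `y`: below 0,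
-- truncated subtraction would break the correspondence.
tab-Shift n {x = x} {y} s with valid? y
tab-Shift n {x = x} {y} s | no ¬v = trans (tab-invalid n x (¬v ∘ Shift-valid⁻¹ s)) (sym (tab-invalid n y ¬v))
tab-Shift zero {x = x} {y} s | yes v = trans (dec-true (valid? x) (Shift-valid s v)) (sym (dec-true (valid? y) v))
tab-Shift (suc n) {x = x} s | yes v = trans
  (⨁-embed s (λ k → tab n (x [ k ]∸ 1)) (tab-invalid n _ dead))
  (sum-cong-≗ λ i → tab-Shift n (Shift-∸ s i (Valid.positive v i)))
  where
  dead : ¬ Valid (x [ final s ]∸ 1)
  dead v = <⇒≢ (∸-room v) (sym (lookup-final s))

-- From partitions to beta-sets

-- The first-column hook lengths plus one, which keeps the value 0 free for dead vectors.
β : ∀ {r} → Vec ℕ r → Vec ℕ r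
β []               = []
β {suc r} (y ∷ ys) = (y + suc r) ∷ β ys

total-β : ∀ {r} (ys : Vec ℕ r) → total (β ys) ≡ base r + sum (toList ys)
total-β [] = refl
total-β {suc r} (y ∷ ys) rewrite total-β ys = begin
  y + suc r + (base r + S)   ≡⟨ cong (_+ (base r + S)) (+-comm y (suc r)) ⟩
  suc r + y + (base r + S)   ≡⟨ +-assoc (suc r) y (base r + S) ⟩
  suc r + (y + (base r + S)) ≡⟨ cong (suc r +_) (+-assoc y (base r) S) ⟨
  suc r + (y + base r + S)   ≡⟨ cong (λ u → suc r + (u + S)) (+-comm y (base r)) ⟩
  suc r + (base r + y + S)   ≡⟨ cong (suc r +_) (+-assoc (base r) y S) ⟩
  suc r + (base r + (y + S)) ≡⟨ +-assoc (suc r) (base r) (y + S) ⟨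
  suc r + base r + (y + S)   ∎
  where
  open ≡-Reasoning
  S = sum (toList ys)

Positive : List ℕ → Set
Positive = All (1 ≤_)

Decreasing : List ℕ → Set
Decreasing = Linked _≥_

β-pred : ∀ {r} (ys : Vec ℕ r) i → Positive (toList ys) → β (ys [ i ]%= pred) ≡ β ys [ i ]∸ 1
β-pred (suc y ∷ ys) zero    (_ ∷ _) = refl
β-pred (y ∷ ys)     (suc i) (_ ∷ p) = cong (_ ∷_) (β-pred ys i p)

sum-pred : ∀ {r} (ys : Vec ℕ r) i → Positive (toList ys) → sum (toList ys) ≡ suc (sum (toList (ys [ i ]%= pred)))
sum-pred (suc y ∷ ys) zero    (_ ∷ _) = refl
sum-pred (y ∷ ys)     (suc i) (_ ∷ p) = trans (cong (y +_) (sum-pred ys i p)) (+-suc y _)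

isDecreasing⇒ : ∀ xs → isDecreasing xs ≡ true → Decreasing xs
isDecreasing⇒ []           _ = []
isDecreasing⇒ (x ∷ [])     _ = [-]
isDecreasing⇒ (x ∷ y ∷ xs) e with y ≤? x | isDecreasing⇒ (y ∷ xs)
... | yes y≤x | rec = y≤x ∷ rec e

isDecreasing⇐ : ∀ {xs} → Decreasing xs → isDecreasing xs ≡ true
isDecreasing⇐ []  = refl
isDecreasing⇐ [-] = refl
isDecreasing⇐ (_∷_ {x} {y} y≤x d) with y ≤? x
... | yes _ = isDecreasing⇐ d
... | no ¬p = contradiction y≤x ¬p

isDecreasing-∷ : ∀ x y xs → y ≤ x → isDecreasing (x ∷ y ∷ xs) ≡ isDecreasing (y ∷ xs)
isDecreasing-∷ x y xs y≤x with y ≤? x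
... | yes _ = refl
... | no ¬p = contradiction y≤x ¬p

-- Shortening row i breaks the order only if the next row is equally long. The beta-entries of two
-- consecutive equal rows differ by exactly 1, so the next row is the witness.
collision : ∀ {r} (ys : Vec ℕ r) i → IsPartition (toList ys) → isDecreasing (toList (ys [ i ]%= pred)) ≡ false →
            ∃ λ j → j ≢ i × lookup (β ys) j ≡ lookup (β ys) i ∸ 1
collision (y ∷ y′ ∷ ys) zero (1≤y ∷ _ , y′≤y ∷ d) e with y′ ≤? pred y
... | yes _ = contradiction e (true≢false (isDecreasing⇐ d))
... | no ¬p with ≤-antisym y′≤y (subst (_≤ y′) (suc-pred y {{>-nonZero 1≤y}}) (≰⇒> ¬p))
...   | refl = suc zero , (λ ()) , sym (cong (_∸ 1) (+-suc y _))
collision (y ∷ y′ ∷ ys) (suc zero) (_ ∷ p , y′≤y ∷ d) e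
  with collision (y′ ∷ ys) zero (p , d) (trans (sym (isDecreasing-∷ y (pred y′) (toList ys) (≤-trans pred[n]≤n y′≤y))) e)
... | j , ne , f = suc j , (λ { refl → ne refl }) , f
collision (y ∷ y′ ∷ ys) (suc (suc i)) (_ ∷ p , y′≤y ∷ d) e
  with collision (y′ ∷ ys) (suc i) (p , d) (trans (sym (isDecreasing-∷ y y′ (toList (ys [ i ]%= pred)) y′≤y)) e)
... | j , ne , f = suc j , (λ { refl → ne refl }) , f

-- Dropping the zero left by a removed row

data DropLast : ∀ {n} → Vec ℕ (suc n) → Vec ℕ n → Set where
  last : DropLast (0 ∷ []) []
  _∷_  : ∀ {n} a {v : Vec ℕ (suc n)} {w} → DropLast v w → DropLast (a ∷ v) (a ∷ w)

-- Relational form of `dropZero` for the candidates that occur: at most one part is zero, and it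
-- stands last. The two lengths are separate indices because the number of rows may change.
data Trim : ∀ {m n} → Vec ℕ m → Vec ℕ n → Set where
  whole : ∀ {n} {v : Vec ℕ n} → Trim v v
  cut   : ∀ {n} {v : Vec ℕ (suc n)} {w} → DropLast v w → Trim v w

Trim-∷ : ∀ {m n} a {v : Vec ℕ m} {w : Vec ℕ n} → Trim v w → Trim (a ∷ v) (a ∷ w)
Trim-∷ a whole   = whole
Trim-∷ a (cut d) = cut (a ∷ d)

β-DropLast : ∀ {n} {v : Vec ℕ (suc n)} {w} → DropLast v w → Shift (β v) (β w)
β-DropLast last = last
β-DropLast (_∷_ {n} a {v} {w} d) = subst (λ u → Shift (u ∷ β v) (β (a ∷ w))) (sym (+-suc a (suc n))) ((a + suc n) ∷ β-DropLast d)

tab-Trim : ∀ k {m n} {v : Vec ℕ m} {w : Vec ℕ n} → Trim v w → tab k (β v) ≡ tab k (β w)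
tab-Trim k whole   = refl
tab-Trim k (cut d) = tab-Shift k (β-DropLast d)

sum-Trim : ∀ {m n} {v : Vec ℕ m} {w : Vec ℕ n} → Trim v w → sum (toList v) ≡ sum (toList w)
sum-Trim whole         = refl
sum-Trim (cut last)    = refl
sum-Trim (cut (a ∷ d)) = cong (a +_) (sum-Trim (cut d))

dropZero-Positive : ∀ {xs} → Positive xs → dropZero xs ≡ xs
dropZero-Positive []            = refl
dropZero-Positive (s≤s z≤n ∷ p) = cong (_ ∷_) (dropZero-Positive p)

dropZero-Trim : ∀ {m n} {v : Vec ℕ m} {w : Vec ℕ n} → Trim v w → Positive (toList w) → dropZero (toList v) ≡ toList w
dropZero-Trim whole p = dropZero-Positive p
dropZero-Trim (cut last) p = refl
dropZero-Trim (cut (suc a ∷ d)) (_ ∷ p) = cong (suc a ∷_) (dropZero-Trim (cut d) p)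

Decreasing-Trim : ∀ {m n} {v : Vec ℕ m} {w : Vec ℕ n} → Trim v w → Decreasing (toList v) → Decreasing (toList w)
Decreasing-Trim whole d = d
Decreasing-Trim (cut last) _ = []
Decreasing-Trim (cut (a ∷ last)) _ = [-]
Decreasing-Trim (cut (a ∷ b ∷ d)) (b≤a ∷ e) = b≤a ∷ Decreasing-Trim (cut (b ∷ d)) e

⊆Y-refl : ∀ xs → xs ⊆Y xs
⊆Y-refl []       = []⊆
⊆Y-refl (x ∷ xs) = ∷⊆ ≤-refl (⊆Y-refl xs)

pred-⊆Y : ∀ {r} (ys : Vec ℕ r) i → toList (ys [ i ]%= pred) ⊆Y toList ys
pred-⊆Y (y ∷ ys) zero    = ∷⊆ pred[n]≤n (⊆Y-refl _)
pred-⊆Y (y ∷ ys) (suc i) = ∷⊆ ≤-refl (pred-⊆Y ys i)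

Trim-⊆Y : ∀ {m n} {v : Vec ℕ m} {w : Vec ℕ n} {xs} → Trim v w → toList v ⊆Y xs → toList w ⊆Y xs
Trim-⊆Y whole s = s
Trim-⊆Y (cut last) s = []⊆
Trim-⊆Y (cut (a ∷ d)) (∷⊆ le s) = ∷⊆ le (Trim-⊆Y (cut d) s)

-- A shortened row becomes zero only if it had length 1; a positive row after it would then violate
-- the order, so it is the last row.
trim : ∀ {r} (ys : Vec ℕ r) i → Positive (toList ys) → Decreasing (toList (ys [ i ]%= pred)) →
       ∃ λ n → Σ (Vec ℕ n) λ w → Trim (ys [ i ]%= pred) w × Positive (toList w)
trim (suc (suc y) ∷ ys) zero (_ ∷ p) _ = _ , _ , whole , s≤s z≤n ∷ p
trim (1 ∷ []) zero _ _ = _ , _ , cut last , []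
trim (1 ∷ y ∷ ys) zero (_ ∷ 1≤y ∷ _) (y≤0 ∷ _) = contradiction (≤-trans 1≤y y≤0) λ ()
trim (y ∷ ys) (suc i) (1≤y ∷ p) d with trim ys i p (Linked.tail d)
... | n , w , t , q = _ , y ∷ w , Trim-∷ y t , 1≤y ∷ q

-- Parity of the number of chains

odd : ℕ → Bool
odd zero    = false
odd (suc n) = not (odd n)

odd-+ : ∀ m n → odd (m + n) ≡ odd m xor odd n
odd-+ zero    n = refl
odd-+ (suc m) n = trans (cong not (odd-+ m n)) (not-distribˡ-xor (odd m) (odd n))

odd⇒%2 : ∀ n → odd n ≡ true → n % 2 ≡ 1
odd⇒%2 (suc zero)    _ = refl
odd⇒%2 (suc (suc n)) e = odd⇒%2 n (trans (sym (not-involutive (odd n))) e)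

%2⇒odd : ∀ n → n % 2 ≡ 1 → odd n ≡ true
%2⇒odd (suc zero)    _ = refl
%2⇒odd (suc (suc n)) e = trans (not-involutive (odd n)) (%2⇒odd n e)

decAt-tabulate : ∀ {r} (ys : Vec ℕ r) → decAt (toList ys) ≡ tabulate (λ i → toList (ys [ i ]%= pred))
decAt-tabulate []       = refl
decAt-tabulate (y ∷ ys) = cong ((pred y ∷ toList ys) ∷_) (trans (cong (map (y ∷_)) (decAt-tabulate ys)) (map-tabulate _ (y ∷_)))

-- Rejected candidates are turned into zero summands, so that the sum runs over all rows and can be
-- compared with `hop` term by term.
odd-sum-filter : ∀ (φ : List ℕ → ℕ) {r} (g : Fin r → List ℕ) →
  odd (sum (map φ (map dropZero (filter (λ ys → isDecreasing ys ≟ᵇ true) (tabulate g)))))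
    ≡ ⨁ (λ i → if isDecreasing (g i) then odd (φ (dropZero (g i))) else false)
odd-sum-filter φ {zero}  g = refl
odd-sum-filter φ {suc r} g with isDecreasing (g zero)
... | true  = trans (odd-+ (φ (dropZero (g zero))) _) (cong (odd (φ (dropZero (g zero))) xor_) (odd-sum-filter φ (g ∘ suc)))
... | false = odd-sum-filter φ (g ∘ suc)

-- Row by row: a rejected candidate corresponds by `collision` to an invalid vector, whose `tab`
-- vanishes; an accepted one falls under the induction hypothesis after trimming, which `tab` does
-- not notice.
odd-chains : ∀ n {r} (ys : Vec ℕ r) → IsPartition (toList ys) → sum (toList ys) ≡ n → odd (chains n (toList ys)) ≡ tab n (β ys)
odd-chains zero [] _ _ = refl
odd-chains zero (suc y ∷ ys) _ ()
odd-chains zero (zero ∷ ys) (() ∷ _ , _) _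
odd-chains (suc n) ys@(_ ∷ _) part@(pos , dec) size = trans
  (cong (λ zs → odd (sum (map (chains n) (map dropZero (filter (λ xs → isDecreasing xs ≟ᵇ true) zs))))) (decAt-tabulate ys))
  (trans (odd-sum-filter (chains n) (λ i → toList (ys [ i ]%= pred))) (sum-cong-≗ term))
  where
  term : ∀ i → (if isDecreasing (toList (ys [ i ]%= pred)) then odd (chains n (dropZero (toList (ys [ i ]%= pred)))) else false)
             ≡ tab n (β ys [ i ]∸ 1)
  term i with isDecreasing (toList (ys [ i ]%= pred)) in e
  ... | false with collision ys i part e
  ...   | j , j≢i , f = sym (tab-invalid n _ λ v → ∸-free 1 v j≢i f)
  term i | true with isDecreasing⇒ _ e
  ...   | d with trim ys i pos d
  ...     | _ , w , t , q = begin
    odd (chains n (dropZero (toList (ys [ i ]%= pred)))) ≡⟨ cong (odd ∘ chains n) (dropZero-Trim t q) ⟩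
    odd (chains n (toList w)) ≡⟨ odd-chains n w (q , Decreasing-Trim t d) (trans (sym (sum-Trim t)) (suc-injective (trans (sym (sum-pred ys i pos)) size))) ⟩
    tab n (β w)               ≡⟨ tab-Trim n t ⟨
    tab n (β (ys [ i ]%= pred)) ≡⟨ cong (tab n) (β-pred ys i pos) ⟩
    tab n (β ys [ i ]∸ 1)     ∎
    where open ≡-Reasoning

-- Covers in Young's lattice and the final assembly

⊆Y⇒sum≤ : ∀ {xs ys} → xs ⊆Y ys → sum xs ≤ sum ys
⊆Y⇒sum≤ []⊆      = z≤n
⊆Y⇒sum≤ (∷⊆ p s) = +-mono-≤ p (⊆Y⇒sum≤ s)

sum≡0 : ∀ {xs} → Positive xs → sum xs ≡ 0 → xs ≡ []
sum≡0 []            _  = refl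
sum≡0 (s≤s z≤n ∷ _) ()

⊆Y∧sum≡⇒≡ : ∀ {xs ys} → Positive ys → xs ⊆Y ys → sum xs ≡ sum ys → xs ≡ ys
⊆Y∧sum≡⇒≡ p []⊆ e = sym (sum≡0 p (sym e))
⊆Y∧sum≡⇒≡ (_ ∷ p) (∷⊆ {x} {y} {xs} {ys} x≤y s) e with m≤n⇒m<n∨m≡n x≤y
... | inj₁ x<y  = contradiction e (<⇒≢ (+-mono-<-≤ x<y (⊆Y⇒sum≤ s)))
... | inj₂ refl = cong (x ∷_) (⊆Y∧sum≡⇒≡ p s (+-cancelˡ-≡ x _ _ e))

toList-≡ : ∀ {m n} (v : Vec ℕ m) (w : Vec ℕ n) → toList v ≡ toList w → Trim v w
toList-≡ []      []      _ = whole
toList-≡ (x ∷ v) (y ∷ w) e with ∷-injective e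
... | refl , e′ = Trim-∷ x (toList-≡ v w e′)

-- As the sizes differ by one, the first row in which the diagrams differ is shorter by exactly one
-- and all later rows agree. If `w` runs out first, a single row of length 1 is left.
covered : ∀ {m n} (w : Vec ℕ m) (ys : Vec ℕ n) → Positive (toList ys) →
          toList w ⊆Y toList ys → sum (toList ys) ≡ suc (sum (toList w)) → ∃ λ i → Trim (ys [ i ]%= pred) w
covered [] (suc y ∷ []) _ []⊆ e with m+n≡0⇒m≡0 y (suc-injective e)
... | refl = zero , cut last
covered [] (suc y ∷ z ∷ ys) (_ ∷ 1≤z ∷ _) []⊆ e = contradiction (sym (m+n≡0⇒m≡0 z (m+n≡0⇒n≡0 y (suc-injective e)))) (<⇒≢ 1≤z)
covered (x ∷ w) (y ∷ ys) (_ ∷ p) (∷⊆ x≤y s) e with m≤n⇒m<n∨m≡n x≤y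
... | inj₂ refl with covered w ys p s (+-cancelˡ-≡ x _ _ (trans e (sym (+-suc x _))))
...   | i , t = suc i , Trim-∷ x t
covered (x ∷ w) (suc y ∷ ys) (_ ∷ p) (∷⊆ x≤y s) e | inj₁ (s≤s x≤y′) with m≤n⇒m<n∨m≡n x≤y′
... | inj₁ x<y  = contradiction (sym (suc-injective e)) (<⇒≢ (+-mono-<-≤ x<y (⊆Y⇒sum≤ s)))
... | inj₂ refl = zero , Trim-∷ x (toList-≡ ys w (sym (⊆Y∧sum≡⇒≡ p s (sym (+-cancelˡ-≡ x _ _ (suc-injective e))))))

-- Existence holds because an odd sum has an odd term; uniqueness is `tab-unique` carried back
-- through `covered`.
unique-odd-lower : ∀ {r} n (ys : Vec ℕ r) → size (toList ys) ≡ suc n → IsPartition (toList ys) → Odd (toList ys) →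
  Σ (List ℕ) λ μ → (μ ⋖ toList ys × Odd μ) × (∀ ν → ν ⋖ toList ys → Odd ν → ν ≡ μ)
unique-odd-lower {r} n ys eq part@(pos , _) oddλ = result (⨁-true _ tab-odd)
  where
  tab-odd : tab (suc n) (β ys) ≡ true
  tab-odd = trans (sym (odd-chains (suc n) ys part eq)) (%2⇒odd (chains (suc n) (toList ys)) (subst (λ k → chains k (toList ys) % 2 ≡ 1) eq oddλ))

  lowered : ∀ {i k} {w : Vec ℕ k} → Trim (ys [ i ]%= pred) w → IsPartition (toList w) →
            odd (f (toList w)) ≡ tab n (β ys [ i ]∸ 1)
  lowered {i} {w = w} t q = begin
    odd (f (toList w))          ≡⟨ odd-chains (size (toList w)) w q refl ⟩
    tab (size (toList w)) (β w)         ≡⟨ cong (λ k → tab k (β w)) size-w ⟩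
    tab n (β w)                 ≡⟨ tab-Trim n t ⟨
    tab n (β (ys [ i ]%= pred)) ≡⟨ cong (tab n) (β-pred ys i pos) ⟩
    tab n (β ys [ i ]∸ 1)       ∎
    where
    open ≡-Reasoning
    size-w : size (toList w) ≡ n
    size-w = trans (sym (sum-Trim t)) (suc-injective (trans (sym (sum-pred ys i pos)) eq))

  result : (∃ λ i → tab n (β ys [ i ]∸ 1) ≡ true) →
    Σ (List ℕ) λ μ → (μ ⋖ toList ys × Odd μ) × (∀ ν → ν ⋖ toList ys → Odd ν → ν ≡ μ)
  result (i , oi) with isDecreasing (toList (ys [ i ]%= pred)) in e
  -- An odd term belongs to a valid vector, so its candidate cannot have been rejected.
  ... | false with collision ys i part e
  ...   | j , j≢i , c = contradiction c (∸-free 1 (tab-valid n oi) j≢i)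
  result (i , oi) | true with isDecreasing⇒ _ e
  ...   | d with trim ys i pos d
  ...     | _ , w , t , q = toList w , (w⋖ys , odd⇒%2 (f (toList w)) (trans (lowered t pw) oi)) , unique
    where
    pw : IsPartition (toList w)
    pw = q , Decreasing-Trim t d
    w⋖ys : toList w ⋖ toList ys
    w⋖ys = pw , part , Trim-⊆Y t (pred-⊆Y ys i) , trans (sum-pred ys i pos) (cong suc (sum-Trim t))
    unique : ∀ ν → ν ⋖ toList ys → Odd ν → ν ≡ toList w
    unique ν (pν , _ , ν⊆ , size-ν) oddν = trans (sym ν≡) (same (covered u ys pos
      (subst (_⊆Y toList ys) (sym ν≡) ν⊆)
      (subst (λ xs → size (toList ys) ≡ suc (size xs)) (sym ν≡) size-ν)))
      where
      u = fromList ν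
      ν≡ : toList u ≡ ν
      ν≡ = toList∘fromList ν
      pu : IsPartition (toList u)
      pu = subst IsPartition (sym ν≡) pν
      same : (∃ λ j → Trim (ys [ j ]%= pred) u) → toList u ≡ toList w
      same (j , tⱼ) with tab-unique n (β ys) (trans (total-β ys) (cong (base r +_) eq)) tab-odd
                          (trans (sym (lowered tⱼ pu)) (%2⇒odd (f (toList u)) (subst Odd (sym ν≡) oddν))) oi
      -- With equal row indices, both partitions are `dropZero` of the same candidate.
      ... | refl = trans (sym (dropZero-Trim tⱼ (proj₁ pu))) (dropZero-Trim t q)

theorem3p1 : (λ′ : List ℕ) → IsPartition λ′ → Odd λ′ → 1 < size λ′ →
    Σ (List ℕ) (λ μ → (μ ⋖ λ′ × Odd μ) ×
    ((ν : List ℕ) → ν ⋖ λ′ → Odd ν → ν ≡ μ))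
theorem3p1 λ′ part oddλ 1<size = subst
  (λ xs → IsPartition xs → Odd xs → 1 < size xs → Σ (List ℕ) (λ μ → (μ ⋖ xs × Odd μ) × ((ν : List ℕ) → ν ⋖ xs → Odd ν → ν ≡ μ)))
  (toList∘fromList λ′)
  (λ p o s → unique-odd-lower _ (fromList λ′) (sym (suc-pred _ {{>-nonZero (<⇒≤ s)}})) p o)
  part oddλ 1<size
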